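{- Let $G=(H,+1)$ be a $k$-uniform, $r$-regular oriented hypergraph in which all incidences are labeled $+1$ and in which any two distinct vertices are adjacent exactly $\lambda$ times. Then $$L(G)=\mathrm H(G)\mathrm H(G)^{\mathrm T}=(r-\lambda)I+\lambda J.$$
   Context: A hypergraph $H=(V,E,\mathcal I)$ consists of a finite set $V=\{v_1,\dots,v_n\}$ of vertices, a finite family $E=(e_1,\dots,e_m)$ of subsets of $V$ (the edges; an edge may be empty, and edges with different indices are regarded as different even if they coincide as sets) and its incidences $\mathcal I$. All hypergraphs are simple: each vertex $v\in e$ is incident with $e$ exactly once, so $\mathcal I=\{(v,e): v\in e\}$. $H$ is $k$-uniform if every edge has exactly $k$ elements and $r$-regular if every vertex lies in exactly $r$ edges (i.e. has degree $r$). Two distinct vertices are adjacent exactly $\lambda$ times if exactly $\lambda$ edges contain both. An oriented hypergraph is a pair $G=(H,\sigma)$ with $\sigma:\mathcal I\to\{+1,-1\}$; $G=(H,+1)$ means $\sigma\equiv+1$. The incidence matrix $\mathrm H(G)$ is the $n\times m$ matrix with $(i,j)$-entry $\sigma(v_i,e_j)$ if $(v_i,e_j)\in\mathcal I$ and $0$ otherwise. For an edge $e$ and distinct $v_i,v_j\in e$, put $\mathrm{sgn}_e(v_i,v_j)=-\sigma(v_i,e)\sigma(v_j,e)$. The adjacency matrix $A(G)=(a_{ij})\in\mathbb R^{n\times n}$ has $a_{ij}=\sum_{e}\mathrm{sgn}_e(v_i,v_j)$ for $i\ne j$, the sum being over all edges $e$ containing both $v_i$ and $v_j$ (so $a_{ij}=0$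 if there are none), and $a_{ii}=0$. The Laplacian matrix is $L(G)=D(G)-A(G)$, where $D(G)$ is the diagonal matrix of vertex degrees. $I$ is the $n\times n$ identity matrix and $J$ the $n\times n$ all-ones matrix. -}

module Defs where

open import Data.Fin using (Fin)
open import Data.Fin.Properties using (_≟_)
open import Data.Fin.Subset using (Subset; _∈_; _∩_; ∣_∣)
open import Data.Fin.Subset.Properties using (_∈?_)
open import Data.Integer using (ℤ; +_; _+_; _-_; _*_; _◃_; 0ℤ; 1ℤ)
open import Data.Integer.Properties using (+-0-monoid)
open import Data.Nat using (ℕ)
open import Data.Sign as Sign using (Sign)
open import Data.Vec using (tabulate)
open import Relation.Binary.PropositionalEquality using (_≡_)
open import Relation.Nullary using (does; yes; no)
open import Algebra.Properties.Monoid.Sum +-0-monoid using (sum)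

-- Every matrix considered here has integer entries, so ℤ serves as the ring
-- of scalars in place of ℝ.

Matrix : ℕ → ℕ → Set
Matrix p q = Fin p → Fin q → ℤ

infix  4 _≈ᴹ_
infixl 6 _+ᴹ_ _-ᴹ_
infixl 7 _*ᴹ_
infixr 8 _·ᴹ_
infix  9 _ᵀ

_≈ᴹ_ : ∀ {p q} → Matrix p q → Matrix p q → Set
M ≈ᴹ N = ∀ i j → M i j ≡ N i j

_+ᴹ_ : ∀ {p q} → Matrix p q → Matrix p q → Matrix p q
(M +ᴹ N) i j = M i j + N i j

_-ᴹ_ : ∀ {p q} → Matrix p q → Matrix p q → Matrix p q
(M -ᴹ N) i j = M i j - N i j

_*ᴹ_ : ∀ {p q s} → Matrix p q → Matrix q s → Matrix p s
(M *ᴹ N) i j = sum (λ l → M i l * N l j)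

_·ᴹ_ : ∀ {p q} → ℤ → Matrix p q → Matrix p q
(c ·ᴹ M) i j = c * M i j

_ᵀ : ∀ {p q} → Matrix p q → Matrix q p
(M ᵀ) i j = M j i

diagonal : ∀ {n} → (Fin n → ℤ) → Matrix n n
diagonal d i j with i ≟ j
... | yes _ = d i
... | no  _ = 0ℤ

identity : ∀ n → Matrix n n
identity n = diagonal (λ _ → 1ℤ)

allOnes : ∀ n → Matrix n n
allOnes n _ _ = 1ℤ

-- Edges form a family indexed by Fin m: they may be empty, and differently
-- indexed edges may coincide as sets. Simplicity is built in, the incidences
-- being exactly the pairs (v , e) with v ∈ edge e.

record Hypergraph (n m : ℕ) : Set where
  field
    edge : Fin m → Subset n

  edgesAt : Fin n → Subset m
  edgesAt v = tabulate (λ e → does (v ∈? edge e))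

  degree : Fin n → ℕ
  degree v = ∣ edgesAt v ∣

  Uniform : ℕ → Set
  Uniform k = ∀ e → ∣ edge e ∣ ≡ k

  Regular : ℕ → Set
  Regular r = ∀ v → degree v ≡ r

  AdjacentTimes : ℕ → Fin n → Fin n → Set
  AdjacentTimes t v w = ∣ edgesAt v ∩ edgesAt w ∣ ≡ t

-- σ takes a membership proof because it is defined on incidences only. Such
-- proofs are unique (Data.Vec.Properties.[]=-irrelevant), so each incidence
-- carries a single sign.

record OrientedHypergraph (n m : ℕ) : Set where
  field
    hypergraph : Hypergraph n m

  open Hypergraph hypergraph public

  field
    σ : ∀ v e → v ∈ edge e → Sign

  AllPositive : Set
  AllPositive = ∀ v e (v∈e : v ∈ edge e) → σ v e v∈e ≡ Sign.+

  incidenceMatrix : Matrix n m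
  incidenceMatrix v e with v ∈? edge e
  ... | yes v∈e = σ v e v∈e ◃ 1
  ... | no  _   = 0ℤ

  sgn : ∀ e v w → v ∈ edge e → w ∈ edge e → Sign
  sgn e v w v∈e w∈e = Sign.opposite (σ v e v∈e Sign.* σ w e w∈e)

  -- The summand of e in an off-diagonal adjacency entry; 0 unless e contains
  -- both vertices.
  edgeContribution : Fin n → Fin n → Fin m → ℤ
  edgeContribution v w e with v ∈? edge e | w ∈? edge e
  ... | yes v∈e | yes w∈e = sgn e v w v∈e w∈e ◃ 1
  ... | yes _   | no _    = 0ℤ
  ... | no _    | _       = 0ℤ

  adjacencyMatrix : Matrix n n
  adjacencyMatrix v w with v ≟ w
  ... | yes _ = 0ℤ
  ... | no  _ = sum (edgeContribution v w)

  degreeMatrix : Matrix n n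
  degreeMatrix = diagonal (λ v → + degree v)

  laplacian : Matrix n n
  laplacian = degreeMatrix -ᴹ adjacencyMatrix

{-# OPTIONS --safe #-}
module Submission where

open import Defs
open import Data.Bool using (Bool; true; false; _∧_; if_then_else_)
open import Data.Fin using (Fin; zero; suc)
open import Data.Fin.Properties using (_≟_)
open import Data.Fin.Subset using (Subset; _∩_; ∣_∣)
open import Data.Fin.Subset.Properties using (_∈?_)
open import Data.Integer using (ℤ; +_; _+_; _-_; _*_; -_; _◃_; 0ℤ; 1ℤ)
open import Data.Integer.Properties
  using (+-0-monoid; +-identityˡ; +-identityʳ; *-zeroʳ;
         neg-distrib-+; neg-involutive)
open import Data.Integer.Tactic.RingSolver using (solve-∀)
open import Data.Nat using (ℕ; zero; suc)
open import Data.Product using (_×_; _,_)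
import Data.Sign as Sign
open import Data.Vec using ([]; _∷_; lookup)
open import Data.Vec.Properties using (lookup∘tabulate; lookup-zipWith)
open import Relation.Binary.PropositionalEquality
open import Relation.Nullary using (does; yes; no)
open import Algebra.Properties.Monoid.Sum +-0-monoid using (sum; sum-cong-≗)

-- Both equalities are checked entry by entry on the Gram matrix of the rows of the incidence
-- matrix. An edge containing `v` and `w` contributes the product of its two signs to entry (v, w).
-- Off the diagonal this is minus its contribution to the adjacency matrix, matching the minus sign
-- in D - A; on the diagonal a sign squares to 1, so the entry counts the edges at `v`, which is the
-- degree. This gives `laplacian≈gram`. When all signs are positive, an off-diagonal entry counts
-- the common edges, so the Gram matrix has `r` on the diagonal and `t` elsewhere (`gram-balanced`).

indicator : Bool → ℤ
indicator b = if b then 1ℤ else 0ℤ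

indicator-∧ : ∀ a b → indicator a * indicator b ≡ indicator (a ∧ b)
indicator-∧ true  true  = refl
indicator-∧ true  false = refl
indicator-∧ false _     = refl

-- Bridge from matrix products, which are integer sums, to degrees and common-edge counts, which are
-- cardinalities of subsets of the edge indices.
sum-indicator : ∀ {m} (S : Subset m) → sum (λ e → indicator (lookup S e)) ≡ + ∣ S ∣
sum-indicator []          = refl
sum-indicator (true ∷ S)  = cong (λ x → 1ℤ + x) (sum-indicator S)
sum-indicator (false ∷ S) = trans (+-identityˡ _) (sum-indicator S)

sum-neg : ∀ {m} (f : Fin m → ℤ) → sum (λ e → - f e) ≡ - sum f
sum-neg {zero}  f = refl
sum-neg {suc m} f =
  trans (cong (λ x → - f zero + x) (sum-neg (λ e → f (suc e))))
        (sym (neg-distrib-+ (f zero) _))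

◃1-opposite-* : ∀ s t → Sign.opposite (s Sign.* t) ◃ 1 ≡ - ((s ◃ 1) * (t ◃ 1))
◃1-opposite-* Sign.+ Sign.+ = refl
◃1-opposite-* Sign.+ Sign.- = refl
◃1-opposite-* Sign.- Sign.+ = refl
◃1-opposite-* Sign.- Sign.- = refl

◃1-square : ∀ s → (s ◃ 1) * (s ◃ 1) ≡ 1ℤ
◃1-square Sign.+ = refl
◃1-square Sign.- = refl

module _ {n m : ℕ} (G : OrientedHypergraph n m) where
  open OrientedHypergraph G
  open ≡-Reasoning

  gram : Matrix n n
  gram = incidenceMatrix *ᴹ incidenceMatrix ᵀ

  lookup-edgesAt-∩ : ∀ v w e →
    lookup (edgesAt v ∩ edgesAt w) e ≡ does (v ∈? edge e) ∧ does (w ∈? edge e)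
  lookup-edgesAt-∩ v w e = trans
    (lookup-zipWith _∧_ e (edgesAt v) (edgesAt w))
    (cong₂ _∧_ (lookup∘tabulate _ e) (lookup∘tabulate _ e))

  -- If both vertices lie in `e`, the minus sign is the `Sign.opposite` in `sgn`; otherwise a zero
  -- incidence entry kills the product.
  edgeContribution-incidence : ∀ v w e →
    edgeContribution v w e ≡ - (incidenceMatrix v e * incidenceMatrix w e)
  edgeContribution-incidence v w e with v ∈? edge e | w ∈? edge e
  ... | yes v∈e | yes w∈e = ◃1-opposite-* (σ v e v∈e) (σ w e w∈e)
  ... | yes v∈e | no  _   = sym (cong -_ (*-zeroʳ (σ v e v∈e ◃ 1)))
  ... | no  _   | _       = refl

  incidence-square : ∀ v e →
    incidenceMatrix v e * incidenceMatrix v e ≡ indicator (does (v ∈? edge e))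
  incidence-square v e with v ∈? edge e
  ... | yes v∈e = ◃1-square (σ v e v∈e)
  ... | no  _   = refl

  gram-diagonal : ∀ v → gram v v ≡ + degree v
  gram-diagonal v = trans
    (sum-cong-≗ λ e → trans (incidence-square v e)
                            (cong indicator (sym (lookup∘tabulate _ e))))
    (sum-indicator (edgesAt v))

  laplacian≈gram : laplacian ≈ᴹ gram
  laplacian≈gram v w with v ≟ w
  -- Adjacency entries vanish on the diagonal, so only the degree is left.
  ... | yes refl = trans (+-identityʳ _) (sym (gram-diagonal v))
  ... | no  _    = begin
    -- The degree matrix contributes the leading zero; the minus of the Laplacian then cancels the
    -- one in `sgn`.
    0ℤ - sum (edgeContribution v w)
      ≡⟨ +-identityˡ _ ⟩
    - sum (edgeContribution v w)
      ≡⟨ cong -_ (sum-cong-≗ (edgeContribution-incidence v w)) ⟩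
    - sum (λ e → - (incidenceMatrix v e * incidenceMatrix w e))
      ≡⟨ cong -_ (sum-neg (λ e → incidenceMatrix v e * incidenceMatrix w e)) ⟩
    - - gram v w
      ≡⟨ neg-involutive _ ⟩
    gram v w ∎

  module _ (positive : AllPositive) where

    incidence-indicator : ∀ v e → incidenceMatrix v e ≡ indicator (does (v ∈? edge e))
    incidence-indicator v e with v ∈? edge e
    ... | yes v∈e = cong (_◃ 1) (positive v e v∈e)
    ... | no  _   = refl

    -- With positive signs the rows are characteristic vectors of the sets of edges at a vertex, and
    -- their inner product is the size of the intersection.
    gram-common-edges : ∀ v w → gram v w ≡ + ∣ edgesAt v ∩ edgesAt w ∣
    gram-common-edges v w = trans (sum-cong-≗ entry) (sum-indicator (edgesAt v ∩ edgesAt w))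
      where
      entry : ∀ e → incidenceMatrix v e * incidenceMatrix w e
                  ≡ indicator (lookup (edgesAt v ∩ edgesAt w) e)
      entry e = begin
        incidenceMatrix v e * incidenceMatrix w e
          ≡⟨ cong₂ _*_ (incidence-indicator v e) (incidence-indicator w e) ⟩
        indicator (does (v ∈? edge e)) * indicator (does (w ∈? edge e))
          ≡⟨ indicator-∧ (does (v ∈? edge e)) (does (w ∈? edge e)) ⟩
        indicator (does (v ∈? edge e) ∧ does (w ∈? edge e))
          ≡⟨ cong indicator (lookup-edgesAt-∩ v w e) ⟨
        indicator (lookup (edgesAt v ∩ edgesAt w) e) ∎

    gram-balanced : ∀ {r t} → Regular r → (∀ v w → v ≢ w → AdjacentTimes t v w) →
      gram ≈ᴹ (+ r - + t) ·ᴹ identity n +ᴹ (+ t) ·ᴹ allOnes n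
    -- The same case split decides the entry of `identity n`, leaving (r - t) + t or 0 + t on the
    -- right.
    gram-balanced {r} {t} regular adjacent v w with v ≟ w
    ... | yes refl = trans (trans (gram-diagonal v) (cong (+_) (regular v)))
                           (onDiagonal (+ r) (+ t))
      where
      onDiagonal : ∀ x y → x ≡ (x - y) * 1ℤ + y * 1ℤ
      onDiagonal = solve-∀
    ... | no  v≢w  = trans (trans (gram-common-edges v w) (cong (+_) (adjacent v w v≢w)))
                           (offDiagonal (+ r) (+ t))
      where
      offDiagonal : ∀ x y → y ≡ (x - y) * 0ℤ + y * 1ℤ
      offDiagonal = solve-∀

theorem6p1 : ∀ {n m : ℕ} (G : OrientedHypergraph n m) (k r t : ℕ) →
    let open OrientedHypergraph G in
    AllPositive →
    Uniform k →
    Regular r →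
    (∀ v w → v ≢ w → AdjacentTimes t v w) →
    (laplacian ≈ᴹ incidenceMatrix *ᴹ incidenceMatrix ᵀ) ×
    (incidenceMatrix *ᴹ incidenceMatrix ᵀ ≈ᴹ (+ r - + t) ·ᴹ identity n +ᴹ (+ t) ·ᴹ allOnes n)
theorem6p1 G k r t positive _ regular adjacent =
  laplacian≈gram G , gram-balanced G positive regular adjacent
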